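{- Let $n\ge 5$ and let $G$ be a connected simple graph with $n$ vertices and $n+1$ edges. Then \[ \operatorname{avm}(G)\ge \frac{4n-11}{2n-5}. \] Moreover, equality holds if and only if $G\cong \theta_n^1(3,3)$.
   Context: For a finite simple graph $G$, a matching is a set of pairwise vertex-disjoint edges; it is maximal if it is not properly contained in another matching. Let $\mathcal{M}(G)$ be the set of maximal matchings of $G$. The average size of maximal matchings is $\operatorname{avm}(G)=\frac{1}{|\mathcal{M}(G)|}\sum_{M\in\mathcal{M}(G)}|M|$. For $n\ge 4$, $\theta_n^1(3,3)$ denotes the graph obtained from $K_4$ minus an edge (vertices $u,v,x,y$ with edges $uv,ux,uy,vx,vy$; i.e. two triangles sharing the edge $uv$) by attaching $n-4$ pendant edges (new leaves) to the vertex $u$, one of the two vertices of degree $3$. -}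

module Defs where

open import Data.Empty using (⊥-elim)
open import Data.Fin as Fin using (Fin; toℕ)
open import Data.Fin.Properties as Fin using (all?)
open import Data.Fin.Subset using (Subset; inside; outside; ∣_∣; _∈_; _⊂_; ⊥)
open import Data.Fin.Subset.Properties using (_∈?_; _⊂?_; anySubset?; ∉⊥; p⊂q⇒∣p∣<∣q∣; ∣p∣≤n)
open import Data.Integer using (+_)
open import Data.List using (List; [_]; _++_; map; length; filter; lookup; allFin; cartesianProduct)
import Data.List.Membership.Propositional as List
open import Data.List.Membership.Propositional.Properties using (∈-map⁺; ∈-++⁺ˡ; ∈-++⁺ʳ; ∈-filter⁺; ∈-length)
open import Data.List.Relation.Unary.Any using (here)
open import Data.Nat using (ℕ; zero; suc; _+_; _*_; _∸_; _≤_; NonZero; z≤n; s≤s; >-nonZero)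
open import Data.Nat.ListAction using (sum)
open import Data.Nat.Properties using (≤-trans; <-≤-trans; n≮n; +-suc; +-identityʳ; m<n⇒0<n∸m; *-monoʳ-≤; +-monoˡ-≤; m≤n+m; m≤m+n)
open import Data.Product using (Σ; ∃; _×_; _,_; proj₁; proj₂)
open import Data.Rational using (ℚ; _/_)
open import Data.Vec using ([]; _∷_)
open import Function using (_on_)
open import Function.Bundles using (_⇔_; _↔_; Inverse)
open import Level using (0ℓ)
open import Relation.Binary using (Rel; Decidable; Symmetric; Irreflexive)
open import Relation.Binary.Construct.Closure.ReflexiveTransitive using (Star)
open import Relation.Binary.Construct.Closure.Symmetric as Sym using (SymClosure; fwd; bwd)
open import Relation.Binary.PropositionalEquality using (_≡_; _≢_; refl; subst)
open import Relation.Nullary using (¬_; yes; no)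
open import Relation.Nullary.Decidable using (_×-dec_; _→-dec_; ¬?)
import Relation.Unary as Unary

record Graph (n : ℕ) : Set₁ where
  field
    Adj        : Rel (Fin n) 0ℓ
    adj?       : Decidable Adj
    adj-sym    : Symmetric Adj
    adj-irrefl : Irreflexive _≡_ Adj

  -- The edge {i , j} is listed once, as the pair (i , j) with i < j.
  edges : List (Fin n × Fin n)
  edges = filter (λ (i , j) → (i Fin.<? j) ×-dec adj? i j)
                 (cartesianProduct (allFin n) (allFin n))

  ∣E∣ : ℕ
  ∣E∣ = length edges

  endpoints : Fin ∣E∣ → Fin n × Fin n
  endpoints = lookup edges

  Connected : Set
  Connected = ∀ i j → Star Adj i j

infix 4 _≅_

_≅_ : ∀ {m n} → Graph m → Graph n → Set
_≅_ {m} {n} G H = Σ (Fin m ↔ Fin n) λ φ →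
  ∀ i j → Graph.Adj G i j ⇔ Graph.Adj H (Inverse.to φ i) (Inverse.to φ j)

Disjoint : ∀ {n} → Rel (Fin n × Fin n) 0ℓ
Disjoint (a , b) (c , d) = (a ≢ c × a ≢ d) × (b ≢ c × b ≢ d)

disjoint? : ∀ {n} → Decidable (Disjoint {n})
disjoint? (a , b) (c , d) =
  (¬? (a Fin.≟ c) ×-dec ¬? (a Fin.≟ d)) ×-dec (¬? (b Fin.≟ c) ×-dec ¬? (b Fin.≟ d))

allSubsets : ∀ m → List (Subset m)
allSubsets zero    = [ [] ]
allSubsets (suc m) = map (inside ∷_) (allSubsets m) ++ map (outside ∷_) (allSubsets m)

∈-allSubsets : ∀ {m} (p : Subset m) → p List.∈ allSubsets m
∈-allSubsets []            = here refl
∈-allSubsets (inside ∷ p)  = ∈-++⁺ˡ (∈-map⁺ (inside ∷_) (∈-allSubsets p))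
∈-allSubsets (outside ∷ p) = ∈-++⁺ʳ (map (inside ∷_) (allSubsets _)) (∈-map⁺ (outside ∷_) (∈-allSubsets p))

module _ {n : ℕ} (G : Graph n) where
  open Graph G

  -- A set of edges is a Subset ∣E∣, i.e. a set of positions in the list edges.
  IsMatching : Subset ∣E∣ → Set
  IsMatching M = ∀ e f → e ∈ M → f ∈ M → e ≢ f → Disjoint (endpoints e) (endpoints f)

  IsMaximalMatching : Subset ∣E∣ → Set
  IsMaximalMatching M = IsMatching M × ¬ (∃ λ M′ → IsMatching M′ × M ⊂ M′)

  isMatching? : Unary.Decidable IsMatching
  isMatching? M = all? λ e → all? λ f →
    (e ∈? M) →-dec (f ∈? M) →-dec ¬? (e Fin.≟ f) →-dec disjoint? (endpoints e) (endpoints f)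

  isMaximalMatching? : Unary.Decidable IsMaximalMatching
  isMaximalMatching? M =
    isMatching? M ×-dec ¬? (anySubset? λ M′ → isMatching? M′ ×-dec (M ⊂? M′))

  maximalMatchings : List (Subset ∣E∣)
  maximalMatchings = filter isMaximalMatching? (allSubsets ∣E∣)

  private
    -- k bounds the number of edges that can still be added to M.
    extend : ∀ k M → ∣E∣ ≤ ∣ M ∣ + k → IsMatching M → ∃ IsMaximalMatching
    extend k M b mM with anySubset? (λ M′ → isMatching? M′ ×-dec (M ⊂? M′))
    ... | no ¬ext = M , mM , ¬ext
    extend zero M b mM | yes (M′ , _ , M⊂M′) =
      ⊥-elim (n≮n _ (<-≤-trans (p⊂q⇒∣p∣<∣q∣ M⊂M′)
        (≤-trans (∣p∣≤n M′) (subst (∣E∣ ≤_) (+-identityʳ ∣ M ∣) b))))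
    extend (suc k) M b mM | yes (M′ , mM′ , M⊂M′) =
      extend k M′
        (≤-trans (subst (∣E∣ ≤_) (+-suc ∣ M ∣ k) b) (+-monoˡ-≤ k (p⊂q⇒∣p∣<∣q∣ M⊂M′)))
        mM′

  ∃-maximalMatching : ∃ IsMaximalMatching
  ∃-maximalMatching =
    extend ∣E∣ ⊥ (m≤n+m ∣E∣ ∣ ⊥ {∣E∣} ∣) (λ e f e∈⊥ → ⊥-elim (∉⊥ e∈⊥))

  maximalMatchings-nonZero : NonZero (length maximalMatchings)
  maximalMatchings-nonZero = >-nonZero (∈-length
    (∈-filter⁺ isMaximalMatching? (∈-allSubsets (proj₁ ∃-maximalMatching)) (proj₂ ∃-maximalMatching)))

  avm : ℚ
  avm = _/_ (+ sum (map ∣_∣ maximalMatchings)) (length maximalMatchings)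
            {{maximalMatchings-nonZero}}

-- u = 0, v = 1, x = 2, y = 3; the vertices 4, …, n − 1 are the leaves attached to u.
data θ-Edge : Rel ℕ 0ℓ where
  uv   : θ-Edge 0 1
  ux   : θ-Edge 0 2
  uy   : θ-Edge 0 3
  vx   : θ-Edge 1 2
  vy   : θ-Edge 1 3
  leaf : ∀ {w} → 4 ≤ w → θ-Edge 0 w

θ-edge? : Decidable θ-Edge
θ-edge? 0 0 = no λ { (leaf ()) }
θ-edge? 0 1 = yes uv
θ-edge? 0 2 = yes ux
θ-edge? 0 3 = yes uy
θ-edge? 0 (suc (suc (suc (suc w)))) = yes (leaf (s≤s (s≤s (s≤s (s≤s z≤n)))))
θ-edge? 1 0 = no λ ()
θ-edge? 1 1 = no λ ()
θ-edge? 1 2 = yes vx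
θ-edge? 1 3 = yes vy
θ-edge? 1 (suc (suc (suc (suc w)))) = no λ ()
θ-edge? (suc (suc _)) _ = no λ ()

θ-Edge-irrefl : ∀ {a} → ¬ θ-Edge a a
θ-Edge-irrefl (leaf ())

symClosure? : ∀ {R : Rel ℕ 0ℓ} → Decidable R → Decidable (SymClosure R)
symClosure? R? a b with R? a b | R? b a
... | yes r | _      = yes (fwd r)
... | no _  | yes r  = yes (bwd r)
... | no ¬r | no ¬r′ = no λ { (fwd r) → ¬r r ; (bwd r) → ¬r′ r }

-- The graph θₙ¹(3,3); meaningful for n ≥ 4 only.
θ¹₃₃ : ∀ n → Graph n
θ¹₃₃ n = record
  { Adj        = SymClosure θ-Edge on toℕ
  ; adj?       = λ i j → symClosure? θ-edge? (toℕ i) (toℕ j)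
  ; adj-sym    = Sym.symmetric θ-Edge
  ; adj-irrefl = λ { refl (fwd r) → θ-Edge-irrefl r ; refl (bwd r) → θ-Edge-irrefl r }
  }

2n∸5-nonZero : ∀ {n} → 5 ≤ n → NonZero (2 * n ∸ 5)
2n∸5-nonZero {n} 5≤n =
  >-nonZero (m<n⇒0<n∸m (≤-trans (m≤m+n 6 4) (*-monoʳ-≤ 2 5≤n)))

-- (4n − 11) / (2n − 5); neither truncated subtraction truncates since n ≥ 5.
bound : ∀ n → 5 ≤ n → ℚ
bound n 5≤n = _/_ (+ (4 * n ∸ 11)) (2 * n ∸ 5) {{2n∸5-nonZero 5≤n}}

{-# OPTIONS --safe #-}

-- A maximal matching of size one is an edge uv meeting every edge.  Without such
-- an edge every maximal matching has at least two edges, so avm G ≥ 2, which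
-- exceeds the bound.  With such an edge, every other vertex is adjacent to u or v,
-- and counting edges shows that exactly two vertices are adjacent to both.  Let p
-- and q be the degrees of u and v minus one; then p + q = n.  The maximal matchings
-- are {uv} and the pq − 2 pairs {uw, vz} with w ≢ z, so their number N = pq − 1
-- equals (2n − 5) + (p − 2)(q − 2), and avm G = 2 − 1/N.  As the bound is
-- 2 − 1/(2n − 5), equality means p = 2 or q = 2, i.e. G ≅ θ¹₃₃ n.
module Submission where

open import Defs
open import Data.Empty using (⊥-elim)
open import Data.Fin as Fin using (Fin; zero; suc; toℕ; fromℕ<)
open import Data.Fin.Properties as Fin using (all?; any?)
open import Data.Fin.Subset as Subset using (Subset; ∣_∣; ⁅_⁆; _∪_; inside; outside)
import Data.Fin.Subset.Properties as Subset
import Data.Integer as ℤ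
import Data.Integer.Properties as ℤ
open import Data.List using (List; []; _∷_; _++_; length; map; filter; lookup; allFin; cartesianProduct)
open import Data.List.Membership.Propositional using (_∈_; lose)
open import Data.List.Membership.Propositional.Properties using (∈-map⁺; ∈-map⁻; ∈-++⁺ˡ; ∈-++⁺ʳ; ∈-++⁻; ∈-filter⁺; ∈-filter⁻; ∈-cartesianProduct⁺; ∈-cartesianProduct⁻; ∈-allFin; ∈-lookup)
open import Data.List.Membership.Propositional.Properties.WithK using (unique∧set⇒bag)
open import Data.List.Properties using (length-map; length-++; length-tabulate; length-filter; filter-all; filter-notAll)
open import Data.List.Relation.Binary.BagAndSetEquality using (∼bag⇒↭)
open import Data.List.Relation.Binary.Permutation.Propositional using (_↭_)
open import Data.List.Relation.Binary.Permutation.Propositional.Properties using (↭-length; map⁺)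
open import Data.List.Relation.Unary.All as All using (All; []; _∷_)
import Data.List.Relation.Unary.All.Properties as All
open import Data.List.Relation.Unary.AllPairs using ([]; _∷_)
open import Data.List.Relation.Unary.Any using (here; there; index)
open import Data.List.Relation.Unary.Any.Properties using (lookup-index)
open import Data.List.Relation.Unary.Unique.Propositional using (Unique)
import Data.List.Relation.Unary.Unique.Propositional.Properties as Unique
open import Data.Nat as ℕ using (ℕ; zero; suc; _+_; _*_; _∸_; _≤_; _<_; NonZero; z≤n; s≤s)
open import Data.Nat.ListAction using (sum)
open import Data.Nat.ListAction.Properties using (sum-↭)
open import Data.Nat.Properties using (+-suc; +-comm; +-identityʳ; suc-injective; +-cancelˡ-≡; +-cancelʳ-≡; +-cancelˡ-≤; +-cancelʳ-≤; +-monoˡ-≤; +-monoʳ-≤; +-mono-≤; *-distribˡ-+; *-zeroʳ; *-monoˡ-≤; *-monoʳ-≤; m≤m+n; m<n+m; m∸n+n≡m; m+n≤o⇒m≤o; m*n≡0⇒m≡0∨n≡0; m∸n≡0⇒m≤n; ≤-trans; ≤-reflexive; ≤-antisym; <⇒≤; <⇒≢; <-irrefl; module ≤-Reasoning)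
open import Data.Nat.Solver using (module +-*-Solver)
open import Data.Product using (∃; _×_; _,_; proj₁; proj₂)
open import Data.Rational as ℚ using (ℚ; _/_)
import Data.Rational.Properties as ℚ
open import Data.Rational.Unnormalised using (mkℚᵘ; *≤*; *≡*)
import Data.Rational.Unnormalised.Properties as ℚᵘ
open import Data.Sum as Sum using (_⊎_; inj₁; inj₂; [_,_]; [_,_]′; swap)
open import Data.Vec using ([]; _∷_)
open import Function using (_∘_)
open import Function.Bundles using (_⇔_; mk⇔; mk↔ₛ′; Inverse; Equivalence)
open import Relation.Binary.Construct.Closure.ReflexiveTransitive using (ε; _◅_)
open import Relation.Binary.Construct.Closure.Symmetric using (SymClosure; fwd; bwd)
open import Relation.Binary.Definitions using (tri<; tri≈; tri>)
open import Relation.Binary.PropositionalEquality using (_≡_; _≢_; refl; sym; trans; cong; cong₂; subst; subst₂; module ≡-Reasoning)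
open import Relation.Nullary using (¬_; Dec; yes; no)
open import Relation.Nullary.Decidable as Dec using (¬?; _×-dec_; _⊎-dec_; _→-dec_; decidable-stable)
import Relation.Unary as Unary

-- Lists without repetitions

private
  variable
    A B : Set
    xs ys : List A

-- The tool behind every count below: a cardinality is found by listing the same elements, without
-- repetition, in a second way.
unique∧set⇒↭ : Unique xs → Unique ys → (∀ {z} → z ∈ xs → z ∈ ys) → (∀ {z} → z ∈ ys → z ∈ xs) → xs ↭ ys
unique∧set⇒↭ xs! ys! xs⊆ys ys⊆xs = ∼bag⇒↭ (unique∧set⇒bag xs! ys! (mk⇔ xs⊆ys ys⊆xs))

-- Injectivity is asked only on the members of `xs`, since `edge s` and `pair` are shown injective
-- only on neighbours and on `distinctPairs`.
map⁺-∈ : ∀ {f : A → B} → (∀ {x y} → x ∈ xs → y ∈ xs → f x ≡ f y → x ≡ y) →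
         Unique xs → Unique (map f xs)
map⁺-∈ {xs = []}    inj []         = []
map⁺-∈ {xs = _ ∷ _} inj (x∉ ∷ xs!) =
  All.map⁺ (All.tabulate λ y∈ fx≡fy → All.lookup x∉ y∈ (inj (here refl) (there y∈) fx≡fy)) ∷
  map⁺-∈ (λ x∈ y∈ → inj (there x∈) (there y∈)) xs!

lookup-injective : Unique xs → ∀ {i j} → lookup xs i ≡ lookup xs j → i ≡ j
lookup-injective (_  ∷ _)   {zero}  {zero}  _  = refl
lookup-injective (x∉ ∷ _)   {zero}  {suc j} eq = ⊥-elim (All.lookup x∉ (∈-lookup j) eq)
lookup-injective (x∉ ∷ _)   {suc i} {zero}  eq = ⊥-elim (All.lookup x∉ (∈-lookup i) (sym eq))
lookup-injective (_  ∷ xs!) {suc i} {suc j} eq = cong suc (lookup-injective xs! eq)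

length-cartesianProduct : ∀ (xs : List A) (ys : List B) →
  length (cartesianProduct xs ys) ≡ length xs * length ys
length-cartesianProduct []       ys = refl
length-cartesianProduct (x ∷ xs) ys = trans (length-++ (map (x ,_) ys))
  (cong₂ _+_ (length-map (x ,_) ys) (length-cartesianProduct xs ys))

module _ {P Q : A → Set} (P? : Unary.Decidable P) (Q? : Unary.Decidable Q) where

  -- Inclusion-exclusion for two predicates that cover the list. Applied to adjacency to u and to v,
  -- it counts the common neighbours.
  length-filter-∪∩ : ∀ {xs} → All (λ x → P x ⊎ Q x) xs →
    length (filter P? xs) + length (filter Q? xs) ≡
    length xs + length (filter (λ x → P? x ×-dec Q? x) xs)
  length-filter-∪∩ {[]} [] = refl
  length-filter-∪∩ {x ∷ xs} (px⊎qx ∷ pqs) with P? x | Q? x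
  ... | yes _ | yes _ = cong suc (trans (+-suc _ _)
                          (trans (cong suc (length-filter-∪∩ pqs)) (sym (+-suc (length xs) _))))
  ... | yes _ | no _  = cong suc (length-filter-∪∩ pqs)
  ... | no _  | yes _ = trans (+-suc _ _) (cong suc (length-filter-∪∩ pqs))
  ... | no ¬p | no ¬q = ⊥-elim ([ ¬p , ¬q ] px⊎qx)

length-filter-∁ : {P : A → Set} (P? : Unary.Decidable P) (xs : List A) →
  length (filter (λ x → ¬? (P? x)) xs) + length (filter P? xs) ≡ length xs
length-filter-∁ P? []       = refl
length-filter-∁ P? (x ∷ xs) with P? x
... | yes _ = trans (+-suc _ _) (cong suc (length-filter-∁ P? xs))
... | no _  = cong suc (length-filter-∁ P? xs)

allSubsets-unique : ∀ m → Unique (allSubsets m)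
allSubsets-unique zero    = [] ∷ []
allSubsets-unique (suc m) = Unique.++⁺
  (Unique.map⁺ (λ { refl → refl }) (allSubsets-unique m))
  (Unique.map⁺ (λ { refl → refl }) (allSubsets-unique m))
  λ (p∈ , q∈) → case-disjoint (∈-map⁻ _ p∈) (∈-map⁻ _ q∈)
  where
  case-disjoint : ∀ {p} → ∃ (λ q → q ∈ allSubsets m × p ≡ inside ∷ q) →
                  ¬ ∃ (λ q → q ∈ allSubsets m × p ≡ outside ∷ q)
  case-disjoint (_ , _ , refl) (_ , _ , ())

∣⁅x⁆∪⁅y⁆∣≡2 : ∀ {m} {x y : Fin m} → x ≢ y → ∣ ⁅ x ⁆ ∪ ⁅ y ⁆ ∣ ≡ 2
∣⁅x⁆∪⁅y⁆∣≡2 {x = zero}  {zero}  x≢y = ⊥-elim (x≢y refl)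
∣⁅x⁆∪⁅y⁆∣≡2 {x = zero}  {suc y} x≢y = cong suc (trans (cong ∣_∣ (Subset.∪-identityˡ ⁅ y ⁆)) (Subset.∣⁅x⁆∣≡1 y))
∣⁅x⁆∪⁅y⁆∣≡2 {x = suc x} {zero}  x≢y = cong suc (trans (cong ∣_∣ (Subset.∪-identityʳ ⁅ x ⁆)) (Subset.∣⁅x⁆∣≡1 x))
∣⁅x⁆∪⁅y⁆∣≡2 {x = suc x} {suc y} x≢y = ∣⁅x⁆∪⁅y⁆∣≡2 (x≢y ∘ cong suc)

-- Comparison of fractions

-- With successor denominators each quotient is `fromℚᵘ` of an unnormalised fraction, so
-- cross-multiplication applies without computing any gcd.
/-≤ : ∀ a b c d .{{_ : NonZero b}} .{{_ : NonZero d}} → a * d ≤ c * b → ℤ.+ a / b ℚ.≤ ℤ.+ c / d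
/-≤ a (suc b) c (suc d) ad≤cb = ℚ.toℚᵘ-cancel-≤
  (ℚᵘ.≤-respˡ-≃ (ℚᵘ.≃-sym (ℚ.toℚᵘ-fromℚᵘ (mkℚᵘ (ℤ.+ a) b)))
    (ℚᵘ.≤-respʳ-≃ (ℚᵘ.≃-sym (ℚ.toℚᵘ-fromℚᵘ (mkℚᵘ (ℤ.+ c) d)))
      (*≤* (subst₂ ℤ._≤_ (ℤ.pos-* a (suc d)) (ℤ.pos-* c (suc b)) (ℤ.+≤+ ad≤cb)))))

/-≡⁺ : ∀ a b c d .{{_ : NonZero b}} .{{_ : NonZero d}} → a * d ≡ c * b → ℤ.+ a / b ≡ ℤ.+ c / d
/-≡⁺ a (suc b) c (suc d) ad≡cb = ℚ.fromℚᵘ-cong {mkℚᵘ (ℤ.+ a) b} {mkℚᵘ (ℤ.+ c) d}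
  (*≡* (trans (sym (ℤ.pos-* a (suc d))) (trans (cong ℤ.+_ ad≡cb) (ℤ.pos-* c (suc b)))))

/-≡⁻ : ∀ a b c d .{{_ : NonZero b}} .{{_ : NonZero d}} → ℤ.+ a / b ≡ ℤ.+ c / d → a * d ≡ c * b
/-≡⁻ a (suc b) c (suc d) eq
  with *≡* eq′ ← ℚ.fromℚᵘ-injective {mkℚᵘ (ℤ.+ a) b} {mkℚᵘ (ℤ.+ c) d} eq =
  ℤ.+-injective (trans (ℤ.pos-* a (suc d)) (trans eq′ (sym (ℤ.pos-* c (suc b)))))

-- Edges and maximal matchings

module Matchings {n : ℕ} (G : Graph n) where
  open Graph G public

  -- Incidence forgets that edges are stored as ordered pairs, so later arguments can treat both
  -- endpoints alike.
  Inc : Fin ∣E∣ → Fin n → Set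
  Inc e a = a ≡ proj₁ (endpoints e) ⊎ a ≡ proj₂ (endpoints e)

  inc? : ∀ e a → Dec (Inc e a)
  inc? e a = (a Fin.≟ proj₁ (endpoints e)) ⊎-dec (a Fin.≟ proj₂ (endpoints e))

  private
    edge-spec : ∀ e → proj₁ (endpoints e) Fin.< proj₂ (endpoints e) × Adj (proj₁ (endpoints e)) (proj₂ (endpoints e))
    edge-spec e = proj₂ (∈-filter⁻ _ {xs = cartesianProduct (allFin n) (allFin n)} (∈-lookup {xs = edges} e))

    ∈-edges : ∀ {a b} → a Fin.< b → Adj a b → (a , b) ∈ edges
    ∈-edges a<b ab = ∈-filter⁺ _ (∈-cartesianProduct⁺ (∈-allFin _) (∈-allFin _)) (a<b , ab)

    edges-unique : Unique edges
    edges-unique = Unique.filter⁺ _ (Unique.cartesianProduct⁺ (Unique.allFin⁺ n) (Unique.allFin⁺ n))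

    endpoints-injective : ∀ {e f} → endpoints e ≡ endpoints f → e ≡ f
    endpoints-injective = lookup-injective edges-unique

  edge-ends : ∀ e → ∃ λ a → ∃ λ b → a ≢ b × Adj a b × Inc e a × Inc e b
  edge-ends e = _ , _ , (λ a≡b → adj-irrefl a≡b (proj₂ (edge-spec e))) , proj₂ (edge-spec e) , inj₁ refl , inj₂ refl

  adj⇒edge : ∀ {a b} → Adj a b → ∃ λ e → Inc e a × Inc e b
  adj⇒edge {a} {b} ab with Fin.<-cmp a b
  ... | tri< a<b _ _  = index p , inj₁ (cong proj₁ (lookup-index p)) , inj₂ (cong proj₂ (lookup-index p))
    where p = ∈-edges a<b ab
  ... | tri≈ _ refl _ = ⊥-elim (adj-irrefl refl ab)
  ... | tri> _ _ b<a  = index p , inj₂ (cong proj₂ (lookup-index p)) , inj₁ (cong proj₁ (lookup-index p))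
    where p = ∈-edges b<a (adj-sym ab)

  inc-cover : ∀ {e a b c} → a ≢ b → Inc e a → Inc e b → Inc e c → c ≡ a ⊎ c ≡ b
  inc-cover a≢b (inj₁ refl) (inj₁ refl) _ = ⊥-elim (a≢b refl)
  inc-cover a≢b (inj₁ refl) (inj₂ refl) c = c
  inc-cover a≢b (inj₂ refl) (inj₁ refl) c = swap c
  inc-cover a≢b (inj₂ refl) (inj₂ refl) _ = ⊥-elim (a≢b refl)

  private
    inc-< : ∀ {e a b} → a Fin.< b → Inc e a → Inc e b → endpoints e ≡ (a , b)
    inc-< a<b (inj₁ refl) (inj₁ refl) = ⊥-elim (Fin.<-irrefl refl a<b)
    inc-< a<b (inj₁ refl) (inj₂ refl) = refl
    inc-< {e} a<b (inj₂ refl) (inj₁ refl) = ⊥-elim (Fin.<-asym a<b (proj₁ (edge-spec e)))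
    inc-< a<b (inj₂ refl) (inj₂ refl) = ⊥-elim (Fin.<-irrefl refl a<b)

  -- There are no parallel edges: comparing `a` with `b` fixes the stored pair, and that pair is
  -- listed only once.
  inc-unique : ∀ {e f a b} → a ≢ b → Inc e a → Inc e b → Inc f a → Inc f b → e ≡ f
  inc-unique {a = a} {b} a≢b ea eb fa fb with Fin.<-cmp a b
  ... | tri< a<b _ _ = endpoints-injective (trans (inc-< a<b ea eb) (sym (inc-< a<b fa fb)))
  ... | tri≈ _ a≡b _ = ⊥-elim (a≢b a≡b)
  ... | tri> _ _ b<a = endpoints-injective (trans (inc-< b<a eb ea) (sym (inc-< b<a fb fa)))

  inc-other : ∀ {e a} → Inc e a → ∃ λ b → a ≢ b × Adj a b × Inc e b
  inc-other {e} (inj₁ refl) = _ , (λ a≡b → adj-irrefl a≡b ab) , ab , inj₂ refl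
    where ab = proj₂ (edge-spec e)
  inc-other {e} (inj₂ refl) = _ , (λ b≡a → adj-irrefl (sym b≡a) ab) , adj-sym ab , inj₁ refl
    where ab = proj₂ (edge-spec e)

  -- Matchings and maximality in terms of incidence

  Disjointᵉ : Fin ∣E∣ → Fin ∣E∣ → Set
  Disjointᵉ e f = Disjoint (endpoints e) (endpoints f)

  disjoint⁺ : ∀ {e f} → (∀ {a} → Inc e a → ¬ Inc f a) → Disjointᵉ e f
  disjoint⁺ e#f = (e#f (inj₁ refl) ∘ inj₁ , e#f (inj₁ refl) ∘ inj₂) , (e#f (inj₂ refl) ∘ inj₁ , e#f (inj₂ refl) ∘ inj₂)

  disjoint⁻ : ∀ {e f} → Disjointᵉ e f → ∀ {a} → Inc e a → ¬ Inc f a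
  disjoint⁻ ((p , _) , _) (inj₁ refl) (inj₁ eq) = p eq
  disjoint⁻ ((_ , p) , _) (inj₁ refl) (inj₂ eq) = p eq
  disjoint⁻ (_ , (p , _)) (inj₂ refl) (inj₁ eq) = p eq
  disjoint⁻ (_ , (_ , p)) (inj₂ refl) (inj₂ eq) = p eq

  Meets : Fin ∣E∣ → Fin ∣E∣ → Set
  Meets e f = ∃ λ a → Inc e a × Inc f a

  meets? : ∀ e f → Dec (Meets e f)
  meets? e f = any? λ a → inc? e a ×-dec inc? f a

  matching-inc : ∀ {M e f a} → IsMatching G M → e Subset.∈ M → f Subset.∈ M → Inc e a → Inc f a → e ≡ f
  matching-inc {e = e} {f} mM e∈ f∈ ea fa with e Fin.≟ f
  ... | yes e≡f = e≡f
  ... | no  e≢f = ⊥-elim (disjoint⁻ (mM e f e∈ f∈ e≢f) ea fa)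

  matching⁺ : ∀ {M} → (∀ {e f a} → e Subset.∈ M → f Subset.∈ M → Inc e a → Inc f a → e ≡ f) → IsMatching G M
  matching⁺ M-inc e f e∈ f∈ e≢f = disjoint⁺ (λ ea fa → e≢f (M-inc e∈ f∈ ea fa))

  -- If `f` met no edge of `M`, then `f` could be added to `M`, contradicting maximality.
  maximal-meets : ∀ {M} → IsMaximalMatching G M → ∀ f → ∃ λ e → e Subset.∈ M × Meets e f
  maximal-meets {M} (mM , ¬ext) f with any? (λ e → (e Subset.∈? M) ×-dec meets? e f)
  ... | yes p = p
  ... | no ¬p = ⊥-elim (¬ext (M ∪ ⁅ f ⁆ , matching⁺ M∪f-inc , Subset.p⊆p∪q ⁅ f ⁆ ,
                              f , Subset.x∈p∪q⁺ (inj₂ (Subset.x∈⁅x⁆ f)) , f∉M))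
    where
    f∉M : f Subset.∉ M
    f∉M f∈M = ¬p (f , f∈M , _ , inj₁ refl , inj₁ refl)

    M∪f-inc : ∀ {e g a} → e Subset.∈ M ∪ ⁅ f ⁆ → g Subset.∈ M ∪ ⁅ f ⁆ → Inc e a → Inc g a → e ≡ g
    M∪f-inc e∈ g∈ ea ga with Subset.x∈p∪q⁻ M ⁅ f ⁆ e∈ | Subset.x∈p∪q⁻ M ⁅ f ⁆ g∈
    ... | inj₁ e∈M | inj₁ g∈M = matching-inc mM e∈M g∈M ea ga
    ... | inj₁ e∈M | inj₂ g∈f with refl ← Subset.x∈⁅y⁆⇒x≡y f g∈f = ⊥-elim (¬p (_ , e∈M , _ , ea , ga))
    ... | inj₂ e∈f | inj₁ g∈M with refl ← Subset.x∈⁅y⁆⇒x≡y f e∈f = ⊥-elim (¬p (_ , g∈M , _ , ga , ea))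
    ... | inj₂ e∈f | inj₂ g∈f = trans (Subset.x∈⁅y⁆⇒x≡y f e∈f) (sym (Subset.x∈⁅y⁆⇒x≡y f g∈f))

  -- A new edge of a larger matching would meet some edge of `M`; as both lie in the larger matching
  -- they coincide.
  meets⇒maximal : ∀ {M} → IsMatching G M → (∀ f → ∃ λ e → e Subset.∈ M × Meets e f) → IsMaximalMatching G M
  meets⇒maximal {M} mM meets = mM , λ { (M′ , mM′ , M⊆M′ , g , g∈M′ , g∉M) →
    let e , e∈M , _ , ea , ga = meets g in
    g∉M (subst (Subset._∈ M) (matching-inc mM′ (M⊆M′ e∈M) g∈M′ ea ga) e∈M) }

  -- Edges that meet every edge

  -- Equivalently, the edge uv alone is a maximal matching. The formulation by adjacency makes the
  -- property decidable by finite search and easy to transport along an isomorphism.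
  record Dominating (u v : Fin n) : Set where
    field
      uv-adj : Adj u v
      meets-uv : ∀ {i j} → Adj i j → (i ≡ u ⊎ i ≡ v) ⊎ (j ≡ u ⊎ j ≡ v)

  dominating-sym : ∀ {u v} → Dominating u v → Dominating v u
  dominating-sym D = record { uv-adj = adj-sym uv-adj ; meets-uv = Sum.map swap swap ∘ meets-uv }
    where open Dominating D

  inc-dominating : ∀ {u v} → Dominating u v → ∀ e → Inc e u ⊎ Inc e v
  inc-dominating D e with edge-ends e
  ... | _ , _ , _ , ab , ea , eb with Dominating.meets-uv D ab
  ...   | inj₁ (inj₁ refl) = inj₁ ea
  ...   | inj₁ (inj₂ refl) = inj₂ ea
  ...   | inj₂ (inj₁ refl) = inj₁ eb
  ...   | inj₂ (inj₂ refl) = inj₂ eb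

  -- If M covers v by an edge vb, a common neighbour x ≢ b gives an edge ux
  -- which M can only meet at u.
  maximal-covers : ∀ {u v M} → Dominating u v → (∀ w → ∃ λ x → x ≢ w × Adj u x × Adj v x) →
    IsMaximalMatching G M → ∃ λ g → g Subset.∈ M × Inc g u
  maximal-covers {u} {v} D common maxM with adj⇒edge (Dominating.uv-adj D)
  ... | e₀ , e₀u , e₀v with maximal-meets maxM e₀
  ...   | g , g∈M , a , ga , e₀a
    with inc? g u | inc-cover (λ u≡v → adj-irrefl u≡v (Dominating.uv-adj D)) e₀u e₀v e₀a
  ...     | yes gu | _         = g , g∈M , gu
  ...     | no ¬gu | inj₁ refl = ⊥-elim (¬gu ga)
  ...     | no ¬gu | inj₂ refl with inc-other ga
  ...       | b , v≢b , vb , gb with common b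
  ...         | x , x≢b , u~x , v~x with adj⇒edge u~x
  ...           | f , fu , fx with maximal-meets maxM f
  ...             | h , h∈M , c , hc , fc with inc-dominating D h
  ...               | inj₁ hu = h , h∈M , hu
  ...               | inj₂ hv with matching-inc (proj₁ maxM) h∈M g∈M hv ga
                               | inc-cover (λ u≡x → adj-irrefl u≡x u~x) fu fx fc
  ...                 | refl | inj₁ refl = ⊥-elim (¬gu hc)
  ...                 | refl | inj₂ refl =
    ⊥-elim ([ (λ x≡v → adj-irrefl (sym x≡v) v~x) , x≢b ] (inc-cover v≢b ga gb hc))

  -- Neighbourhoods of the ends of a dominating edge

  module Structure (connected : Connected) {u v : Fin n} (D : Dominating u v) (∣E∣≡n+1 : ∣E∣ ≡ n + 1) where
    open Dominating D

    u≢v : u ≢ v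
    u≢v u≡v = adj-irrefl u≡v uv-adj

    others : List (Fin n)
    others = filter (λ w → ¬? (w Fin.≟ u) ×-dec ¬? (w Fin.≟ v)) (allFin n)

    nbrs : Fin n → List (Fin n)
    nbrs s = filter (adj? s) others

    common : List (Fin n)
    common = filter (λ w → adj? u w ×-dec adj? v w) others

    ∈-others⁺ : ∀ {w} → w ≢ u → w ≢ v → w ∈ others
    ∈-others⁺ w≢u w≢v = ∈-filter⁺ _ (∈-allFin _) (w≢u , w≢v)

    ∈-others⁻ : ∀ {w} → w ∈ others → w ≢ u × w ≢ v
    ∈-others⁻ w∈ = proj₂ (∈-filter⁻ _ {xs = allFin n} w∈)

    ∈-nbrs⁺ : ∀ {s w} → w ∈ others → Adj s w → w ∈ nbrs s
    ∈-nbrs⁺ {s} = ∈-filter⁺ (adj? s)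

    ∈-nbrs⁻ : ∀ {s w} → w ∈ nbrs s → w ∈ others × Adj s w
    ∈-nbrs⁻ {s} = ∈-filter⁻ (adj? s)

    ∈-common⁻ : ∀ {w} → w ∈ common → w ∈ others × Adj u w × Adj v w
    ∈-common⁻ = ∈-filter⁻ (λ w → adj? u w ×-dec adj? v w)

    ∈-common⁺ : ∀ {w} → w ∈ others → Adj u w → Adj v w → w ∈ common
    ∈-common⁺ w∈ uw vw = ∈-filter⁺ (λ w → adj? u w ×-dec adj? v w) w∈ (uw , vw)

    others-unique : Unique others
    others-unique = Unique.filter⁺ _ (Unique.allFin⁺ n)

    nbrs-unique : ∀ s → Unique (nbrs s)
    nbrs-unique s = Unique.filter⁺ (adj? s) others-unique

    common-unique : Unique common
    common-unique = Unique.filter⁺ _ others-unique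

    -- The first edge of a path from `w` to u contains u or v, and `w` is neither, so its other end
    -- is.
    others-adj : ∀ {w} → w ∈ others → Adj u w ⊎ Adj v w
    others-adj {w} w∈ with connected w u
    ... | ε = ⊥-elim (proj₁ (∈-others⁻ w∈) refl)
    ... | wz ◅ _ with meets-uv wz
    ...   | inj₁ w≡u⊎v        = ⊥-elim ([ proj₁ (∈-others⁻ w∈) , proj₂ (∈-others⁻ w∈) ] w≡u⊎v)
    ...   | inj₂ (inj₁ refl) = inj₁ (adj-sym wz)
    ...   | inj₂ (inj₂ refl) = inj₂ (adj-sym wz)

    ∣others∣ : 2 + length others ≡ n
    ∣others∣ = trans (↭-length perm) (length-tabulate _)
      where
      perm : u ∷ v ∷ others ↭ allFin n
      perm = unique∧set⇒↭
        ((u≢v ∷ All.tabulate (λ w∈ u≡w → proj₁ (∈-others⁻ w∈) (sym u≡w))) ∷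
         All.tabulate (λ w∈ v≡w → proj₂ (∈-others⁻ w∈) (sym v≡w)) ∷ others-unique)
        (Unique.allFin⁺ n) (λ _ → ∈-allFin _) (λ {w} _ → split w)
        where
        split : ∀ w → w ∈ u ∷ v ∷ others
        split w with w Fin.≟ u | w Fin.≟ v
        ... | yes refl | _        = here refl
        ... | no _     | yes refl = there (here refl)
        ... | no w≢u   | no w≢v   = there (there (∈-others⁺ w≢u w≢v))

    private
      uv-edge = adj⇒edge uv-adj

    e₀ : Fin ∣E∣
    e₀ = proj₁ uv-edge

    e₀u : Inc e₀ u
    e₀u = proj₁ (proj₂ uv-edge)

    e₀v : Inc e₀ v
    e₀v = proj₂ (proj₂ uv-edge)

    -- The value e₀ for non-adjacent pairs is junk.
    edge : Fin n → Fin n → Fin ∣E∣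
    edge a b with adj? a b
    ... | yes ab = proj₁ (adj⇒edge ab)
    ... | no _   = e₀

    edge-inc : ∀ {a b} → Adj a b → Inc (edge a b) a × Inc (edge a b) b
    edge-inc {a} {b} ab with adj? a b
    ... | yes ab′ = proj₂ (adj⇒edge ab′)
    ... | no ¬ab  = ⊥-elim (¬ab ab)

    edge-inc⁻ : ∀ {a b c} → Adj a b → Inc (edge a b) c → c ≡ a ⊎ c ≡ b
    edge-inc⁻ ab = inc-cover (λ a≡b → adj-irrefl a≡b ab) (proj₁ (edge-inc ab)) (proj₂ (edge-inc ab))

    edge-injective : ∀ {s w z} → Adj s w → Adj s z → edge s w ≡ edge s z → w ≡ z
    edge-injective {s} {w} sw sz eq
      with edge-inc⁻ sz (subst (λ e → Inc e w) eq (proj₂ (edge-inc sw)))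
    ... | inj₁ w≡s = ⊥-elim (adj-irrefl (sym w≡s) sw)
    ... | inj₂ w≡z = w≡z

    edge-u-∌v : ∀ {w} → w ∈ nbrs u → ¬ Inc (edge u w) v
    edge-u-∌v w∈ i with w∈o , uw ← ∈-nbrs⁻ {u} w∈ with edge-inc⁻ uw i
    ... | inj₁ v≡u = u≢v (sym v≡u)
    ... | inj₂ v≡w = proj₂ (∈-others⁻ w∈o) (sym v≡w)

    edge-v-∌u : ∀ {w} → w ∈ nbrs v → ¬ Inc (edge v w) u
    edge-v-∌u w∈ i with w∈o , vw ← ∈-nbrs⁻ {v} w∈ with edge-inc⁻ vw i
    ... | inj₁ u≡v = u≢v u≡v
    ... | inj₂ u≡w = proj₁ (∈-others⁻ w∈o) (sym u≡w)

    edge-nbr : ∀ {s w} → w ∈ nbrs s → Inc (edge s w) s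
    edge-nbr w∈ = proj₁ (edge-inc (proj₂ (∈-nbrs⁻ w∈)))

    edges-at-u : ∀ {e} → Inc e u → e ≡ e₀ ⊎ ∃ λ w → w ∈ nbrs u × e ≡ edge u w
    edges-at-u eu with inc-other eu
    ... | b , u≢b , ub , eb with b Fin.≟ v
    ...   | yes refl = inj₁ (inc-unique u≢b eu eb e₀u e₀v)
    ...   | no b≢v   = inj₂ (b , ∈-nbrs⁺ (∈-others⁺ (u≢b ∘ sym) b≢v) ub ,
                         inc-unique u≢b eu eb (proj₁ (edge-inc ub)) (proj₂ (edge-inc ub)))

    edges-at-v : ∀ {e} → Inc e v → e ≡ e₀ ⊎ ∃ λ w → w ∈ nbrs v × e ≡ edge v w
    edges-at-v ev with inc-other ev
    ... | b , v≢b , vb , eb with b Fin.≟ u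
    ...   | yes refl = inj₁ (inc-unique v≢b ev eb e₀v e₀u)
    ...   | no b≢u   = inj₂ (b , ∈-nbrs⁺ (∈-others⁺ b≢u (v≢b ∘ sym)) vb ,
                         inc-unique v≢b ev eb (proj₁ (edge-inc vb)) (proj₂ (edge-inc vb)))

    -- Every edge contains u or v and only `e₀` contains both, so the remaining edges split into
    -- those at u and those at v.
    ∣E∣≡1+∣nbrs∣ : ∣E∣ ≡ 1 + (length (nbrs u) + length (nbrs v))
    ∣E∣≡1+∣nbrs∣ = trans (sym (length-tabulate _)) (trans (↭-length perm)
      (cong suc (trans (length-++ (map (edge u) (nbrs u)))
        (cong₂ _+_ (length-map (edge u) (nbrs u)) (length-map (edge v) (nbrs v))))))
      where
      split : ∀ e → e ∈ e₀ ∷ map (edge u) (nbrs u) ++ map (edge v) (nbrs v)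
      split e with inc-dominating D e
      split e | inj₁ eu with edges-at-u eu
      ... | inj₁ e≡e₀            = here e≡e₀
      ... | inj₂ (_ , w∈ , refl) = there (∈-++⁺ˡ (∈-map⁺ (edge u) w∈))
      split e | inj₂ ev with edges-at-v ev
      ... | inj₁ e≡e₀            = here e≡e₀
      ... | inj₂ (_ , w∈ , refl) = there (∈-++⁺ʳ (map (edge u) (nbrs u)) (∈-map⁺ (edge v) w∈))

      u-edge-∌v : ∀ {e} → e ∈ map (edge u) (nbrs u) → ¬ Inc e v
      u-edge-∌v e∈ with _ , w∈ , refl ← ∈-map⁻ (edge u) e∈ = edge-u-∌v w∈

      v-edge-∋v∌u : ∀ {e} → e ∈ map (edge v) (nbrs v) → Inc e v × ¬ Inc e u
      v-edge-∋v∌u e∈ with _ , w∈ , refl ← ∈-map⁻ (edge v) e∈ = edge-nbr w∈ , edge-v-∌u w∈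

      unique : ∀ s → Unique (map (edge s) (nbrs s))
      unique s = map⁺-∈ (λ w∈ z∈ → edge-injective (proj₂ (∈-nbrs⁻ w∈)) (proj₂ (∈-nbrs⁻ z∈))) (nbrs-unique s)

      perm : allFin ∣E∣ ↭ e₀ ∷ map (edge u) (nbrs u) ++ map (edge v) (nbrs v)
      perm = unique∧set⇒↭ (Unique.allFin⁺ ∣E∣)
        (All.tabulate (λ e∈ → λ { refl → [ (λ e∈u → u-edge-∌v e∈u e₀v) , (λ e∈v → proj₂ (v-edge-∋v∌u e∈v) e₀u) ]
                                           (∈-++⁻ (map (edge u) (nbrs u)) e∈) }) ∷
         Unique.++⁺ (unique u) (unique v) (λ (e∈u , e∈v) → u-edge-∌v e∈u (proj₁ (v-edge-∋v∌u e∈v))))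
        (λ _ → split _) (λ _ → ∈-allFin _)

    ∣nbrs∣-∪∩ : length (nbrs u) + length (nbrs v) ≡ length others + length common
    ∣nbrs∣-∪∩ = length-filter-∪∩ (adj? u) (adj? v) (All.tabulate others-adj)

    ∣nbrs∣≡n : length (nbrs u) + length (nbrs v) ≡ n
    ∣nbrs∣≡n = suc-injective (trans (sym ∣E∣≡1+∣nbrs∣) (trans ∣E∣≡n+1 (+-comm n 1)))

    -- The two neighbourhoods cover the n - 2 other vertices, while their sizes add up to n; the
    -- overlap is the excess.
    ∣common∣≡2 : length common ≡ 2
    ∣common∣≡2 = +-cancelˡ-≡ (length others) _ _
      (trans (sym ∣nbrs∣-∪∩) (trans ∣nbrs∣≡n (trans (sym ∣others∣) (+-comm 2 _))))

    ∃-common : ∃ λ x → ∃ λ y → x ≢ y × common ≡ x ∷ y ∷ []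
    ∃-common = pick common ∣common∣≡2 common-unique
      where
      pick : ∀ xs → length xs ≡ 2 → Unique xs → ∃ λ x → ∃ λ y → x ≢ y × xs ≡ x ∷ y ∷ []
      pick (x ∷ y ∷ []) refl ((x≢y ∷ []) ∷ _) = x , y , x≢y , refl

    -- At most one of the two common neighbours equals `w`. This is the hypothesis that
    -- `maximal-covers` needs.
    ∃-common-≢ : ∀ w → ∃ λ x → x ≢ w × Adj u x × Adj v x
    ∃-common-≢ w with x , y , x≢y , eq ← ∃-common with x Fin.≟ w
    ... | no x≢w   = x , x≢w , proj₂ (∈-common⁻ (subst (x ∈_) (sym eq) (here refl)))
    ... | yes refl = y , x≢y ∘ sym , proj₂ (∈-common⁻ (subst (y ∈_) (sym eq) (there (here refl))))

    -- The list of all maximal matchings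

    -- The condition `w ≢ z` is exactly what makes the edges uw and vz disjoint.
    distinctPairs : List (Fin n × Fin n)
    distinctPairs = filter (λ (w , z) → ¬? (w Fin.≟ z)) (cartesianProduct (nbrs u) (nbrs v))

    ∈-distinctPairs⁻ : ∀ {w z} → (w , z) ∈ distinctPairs → w ∈ nbrs u × z ∈ nbrs v × w ≢ z
    ∈-distinctPairs⁻ wz∈
      with wz∈× , w≢z ← ∈-filter⁻ (λ (w , z) → ¬? (w Fin.≟ z)) {xs = cartesianProduct (nbrs u) (nbrs v)} wz∈
      with w∈ , z∈ ← ∈-cartesianProduct⁻ (nbrs u) (nbrs v) wz∈× = w∈ , z∈ , w≢z

    pair : Fin n × Fin n → Subset ∣E∣
    pair (w , z) = ⁅ edge u w ⁆ ∪ ⁅ edge v z ⁆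

    ∈-pair⁻ : ∀ {e} wz → e Subset.∈ pair wz → e ≡ edge u (proj₁ wz) ⊎ e ≡ edge v (proj₂ wz)
    ∈-pair⁻ (w , z) e∈ = Sum.map (Subset.x∈⁅y⁆⇒x≡y _) (Subset.x∈⁅y⁆⇒x≡y _) (Subset.x∈p∪q⁻ ⁅ edge u w ⁆ ⁅ edge v z ⁆ e∈)

    uw∈pair : ∀ w z → edge u w Subset.∈ pair (w , z)
    uw∈pair w z = Subset.x∈p∪q⁺ (inj₁ (Subset.x∈⁅x⁆ _))

    vz∈pair : ∀ w z → edge v z Subset.∈ pair (w , z)
    vz∈pair w z = Subset.x∈p∪q⁺ {p = ⁅ edge u w ⁆} (inj₂ (Subset.x∈⁅x⁆ _))

    -- The two edges of a pair are told apart by which of u and v they contain, so equal pairs agree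
    -- edge by edge.
    pair-injective : ∀ {p q} → p ∈ distinctPairs → q ∈ distinctPairs → pair p ≡ pair q → p ≡ q
    pair-injective {w , z} {w′ , z′} p∈ q∈ eq
      with w∈ , z∈ , _ ← ∈-distinctPairs⁻ p∈ | w′∈ , z′∈ , _ ← ∈-distinctPairs⁻ q∈
      with ∈-pair⁻ (w′ , z′) (subst (edge u w Subset.∈_) eq (uw∈pair w z))
         | ∈-pair⁻ (w′ , z′) (subst (edge v z Subset.∈_) eq (vz∈pair w z))
    ... | inj₂ uw≡vz′ | _           = ⊥-elim (edge-v-∌u z′∈ (subst (λ e → Inc e u) uw≡vz′ (edge-nbr w∈)))
    ... | inj₁ _      | inj₁ vz≡uw′ = ⊥-elim (edge-u-∌v w′∈ (subst (λ e → Inc e v) vz≡uw′ (edge-nbr z∈)))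
    ... | inj₁ uw≡    | inj₂ vz≡    = cong₂ _,_
      (edge-injective (proj₂ (∈-nbrs⁻ w∈)) (proj₂ (∈-nbrs⁻ w′∈)) uw≡)
      (edge-injective (proj₂ (∈-nbrs⁻ z∈)) (proj₂ (∈-nbrs⁻ z′∈)) vz≡)

    edges-disjoint : ∀ {w z a} → (w , z) ∈ distinctPairs → Inc (edge u w) a → ¬ Inc (edge v z) a
    edges-disjoint wz∈ ia ja with w∈ , z∈ , w≢z ← ∈-distinctPairs⁻ wz∈
      with edge-inc⁻ (proj₂ (∈-nbrs⁻ w∈)) ia
    ... | inj₁ refl = edge-v-∌u z∈ ja
    ... | inj₂ refl with edge-inc⁻ (proj₂ (∈-nbrs⁻ z∈)) ja
    ...   | inj₁ refl = edge-u-∌v w∈ ia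
    ...   | inj₂ w≡z  = w≢z w≡z

    -- The two edges are disjoint and together cover u and v, and every edge contains one of these.
    pair-maximal : ∀ {p} → p ∈ distinctPairs → IsMaximalMatching G (pair p)
    pair-maximal {w , z} p∈ with w∈ , z∈ , _ ← ∈-distinctPairs⁻ p∈ = meets⇒maximal (matching⁺ pair-inc) meets
      where
      pair-inc : ∀ {e f a} → e Subset.∈ pair (w , z) → f Subset.∈ pair (w , z) → Inc e a → Inc f a → e ≡ f
      pair-inc e∈ f∈ ea fa with ∈-pair⁻ (w , z) e∈ | ∈-pair⁻ (w , z) f∈
      ... | inj₁ refl | inj₁ refl = refl
      ... | inj₁ refl | inj₂ refl = ⊥-elim (edges-disjoint p∈ ea fa)
      ... | inj₂ refl | inj₁ refl = ⊥-elim (edges-disjoint p∈ fa ea)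
      ... | inj₂ refl | inj₂ refl = refl

      meets : ∀ f → ∃ λ e → e Subset.∈ pair (w , z) × Meets e f
      meets f with inc-dominating D f
      ... | inj₁ fu = edge u w , uw∈pair w z , u , edge-nbr w∈ , fu
      ... | inj₂ fv = edge v z , vz∈pair w z , v , edge-nbr z∈ , fv

    e₀-maximal : IsMaximalMatching G ⁅ e₀ ⁆
    e₀-maximal = meets⇒maximal
      (matching⁺ (λ e∈ f∈ _ _ → trans (Subset.x∈⁅y⁆⇒x≡y e₀ e∈) (sym (Subset.x∈⁅y⁆⇒x≡y e₀ f∈))))
      λ f → e₀ , Subset.x∈⁅x⁆ e₀ , [ (λ fu → u , e₀u , fu) , (λ fv → v , e₀v , fv) ]′ (inc-dominating D f)

    -- By `maximal-covers` in both directions, `M` has an edge `g` at u and an edge `h` at v. It has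
    -- no further edge, because every edge shares u with `g` or v with `h`.
    maximal⇒e₀⊎pair : ∀ {M} → IsMaximalMatching G M → M ∈ ⁅ e₀ ⁆ ∷ map pair distinctPairs
    maximal⇒e₀⊎pair {M} maxM
      with g , g∈M , gu ← maximal-covers D ∃-common-≢ maxM
         | h , h∈M , hv ← maximal-covers (dominating-sym D)
             (λ w → let x , x≢w , u~x , v~x = ∃-common-≢ w in x , x≢w , v~x , u~x) maxM
      with edges-at-u gu | edges-at-v hv
    ... | inj₁ refl | _ = here (Subset.⊆-antisym
            (λ {f} f∈M → subst (Subset._∈ ⁅ e₀ ⁆) (sym (M⊆e₀ f∈M)) (Subset.x∈⁅x⁆ e₀))
            (λ {f} f∈e₀ → subst (Subset._∈ M) (sym (Subset.x∈⁅y⁆⇒x≡y e₀ f∈e₀)) g∈M))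
      where
      M⊆e₀ : ∀ {f} → f Subset.∈ M → f ≡ e₀
      M⊆e₀ {f} f∈M with inc-dominating D f
      ... | inj₁ fu = matching-inc (proj₁ maxM) f∈M g∈M fu gu
      ... | inj₂ fv = matching-inc (proj₁ maxM) f∈M g∈M fv e₀v
    -- Here `h` is uv and shares u with `g`, so they coincide and uw would contain v.
    ... | inj₂ (w , w∈ , refl) | inj₁ refl =
            ⊥-elim (edge-u-∌v w∈ (subst (λ e → Inc e v) (matching-inc (proj₁ maxM) h∈M g∈M e₀u gu) e₀v))
    ... | inj₂ (w , w∈ , refl) | inj₂ (z , z∈ , refl) =
            there (subst (_∈ map pair distinctPairs) (sym M≡pair) (∈-map⁺ pair wz∈))
      where
      w≢z : w ≢ z
      -- Otherwise `g` and `h` share `w`, hence coincide, and vz would contain u.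
      w≢z refl = edge-v-∌u z∈ (subst (λ e → Inc e u)
        (matching-inc (proj₁ maxM) g∈M h∈M
          (proj₂ (edge-inc (proj₂ (∈-nbrs⁻ w∈)))) (proj₂ (edge-inc (proj₂ (∈-nbrs⁻ z∈))))) gu)

      wz∈ : (w , z) ∈ distinctPairs
      wz∈ = ∈-filter⁺ _ (∈-cartesianProduct⁺ w∈ z∈) w≢z

      M⊆pair : ∀ {f} → f Subset.∈ M → f Subset.∈ pair (w , z)
      M⊆pair {f} f∈M with inc-dominating D f
      ... | inj₁ fu with refl ← matching-inc (proj₁ maxM) f∈M g∈M fu gu = uw∈pair w z
      ... | inj₂ fv with refl ← matching-inc (proj₁ maxM) f∈M h∈M fv hv = vz∈pair w z

      pair⊆M : ∀ {f} → f Subset.∈ pair (w , z) → f Subset.∈ M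
      pair⊆M f∈ with ∈-pair⁻ (w , z) f∈
      ... | inj₁ refl = g∈M
      ... | inj₂ refl = h∈M

      M≡pair : M ≡ pair (w , z)
      M≡pair = Subset.⊆-antisym M⊆pair pair⊆M

    maximalMatchings-↭ : maximalMatchings G ↭ ⁅ e₀ ⁆ ∷ map pair distinctPairs
    maximalMatchings-↭ = unique∧set⇒↭
      (Unique.filter⁺ (isMaximalMatching? G) (allSubsets-unique ∣E∣))
      (All.tabulate e₀∉ ∷ map⁺-∈ pair-injective
        (Unique.filter⁺ _ (Unique.cartesianProduct⁺ (nbrs-unique u) (nbrs-unique v))))
      (λ M∈ → maximal⇒e₀⊎pair (proj₂ (∈-filter⁻ (isMaximalMatching? G) {xs = allSubsets ∣E∣} M∈)))
      (λ M∈ → ∈-filter⁺ (isMaximalMatching? G) (∈-allSubsets _) (maximal M∈))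
      where
      e₀∉ : ∀ {M} → M ∈ map pair distinctPairs → ⁅ e₀ ⁆ ≢ M
      e₀∉ M∈ eq with (w , z) , wz∈ , refl ← ∈-map⁻ pair M∈ =
        edge-u-∌v (proj₁ (∈-distinctPairs⁻ wz∈))
          (subst (λ e → Inc e v) (sym (Subset.x∈⁅y⁆⇒x≡y e₀ (subst (edge u w Subset.∈_) (sym eq) (uw∈pair w z)))) e₀v)

      maximal : ∀ {M} → M ∈ ⁅ e₀ ⁆ ∷ map pair distinctPairs → IsMaximalMatching G M
      maximal (here refl) = e₀-maximal
      maximal (there M∈) with _ , wz∈ , refl ← ∈-map⁻ pair M∈ = pair-maximal wz∈

    -- Number and total size of the maximal matchings

    -- The pairs removed from the product of the neighbourhoods form its diagonal, which is a copy
    -- of the two common neighbours.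
    ∣distinctPairs∣ : 2 + length distinctPairs ≡ length (nbrs u) * length (nbrs v)
    ∣distinctPairs∣ = trans (+-comm 2 _) (trans
      (cong (length distinctPairs +_)
        (sym (trans (↭-length perm) (trans (length-map _ common) ∣common∣≡2))))
      (trans (length-filter-∁ eq? (cartesianProduct (nbrs u) (nbrs v))) (length-cartesianProduct (nbrs u) (nbrs v))))
      where
      eq? : ∀ (wz : Fin n × Fin n) → Dec (proj₁ wz ≡ proj₂ wz)
      eq? (w , z) = w Fin.≟ z

      diagonal⁻ : ∀ {p} → p ∈ filter eq? (cartesianProduct (nbrs u) (nbrs v)) → p ∈ map (λ x → x , x) common
      diagonal⁻ {w , z} p∈ with p∈× , refl ← ∈-filter⁻ eq? {xs = cartesianProduct (nbrs u) (nbrs v)} p∈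
        with w∈ , z∈ ← ∈-cartesianProduct⁻ (nbrs u) (nbrs v) p∈× =
        ∈-map⁺ _ (∈-common⁺ (proj₁ (∈-nbrs⁻ {u} w∈)) (proj₂ (∈-nbrs⁻ w∈)) (proj₂ (∈-nbrs⁻ z∈)))

      diagonal⁺ : ∀ {p} → p ∈ map (λ x → x , x) common → p ∈ filter eq? (cartesianProduct (nbrs u) (nbrs v))
      diagonal⁺ p∈ with x , x∈ , refl ← ∈-map⁻ _ p∈ with x∈o , u~x , v~x ← ∈-common⁻ x∈ =
        ∈-filter⁺ eq? (∈-cartesianProduct⁺ (∈-nbrs⁺ x∈o u~x) (∈-nbrs⁺ x∈o v~x)) refl

      perm : filter eq? (cartesianProduct (nbrs u) (nbrs v)) ↭ map (λ x → x , x) common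
      perm = unique∧set⇒↭
        (Unique.filter⁺ eq? (Unique.cartesianProduct⁺ (nbrs-unique u) (nbrs-unique v)))
        (Unique.map⁺ (cong proj₁) common-unique) diagonal⁻ diagonal⁺

    ∣maximalMatchings∣ : 1 + length (maximalMatchings G) ≡ length (nbrs u) * length (nbrs v)
    ∣maximalMatchings∣ = trans (cong suc (trans (↭-length maximalMatchings-↭) (cong suc (length-map pair distinctPairs)))) ∣distinctPairs∣

    -- Every maximal matching has two edges except `⁅ e₀ ⁆`, which has one.
    sum-sizes : 1 + sum (map ∣_∣ (maximalMatchings G)) ≡ 2 * length (maximalMatchings G)
    sum-sizes = trans
      (cong suc (trans (sum-↭ (map⁺ ∣_∣ maximalMatchings-↭))
        (cong₂ _+_ (Subset.∣⁅x⁆∣≡1 e₀) (sum-pairs distinctPairs (λ p∈ → p∈)))))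
      (trans (sym (*-distribˡ-+ 2 1 _)) (cong (2 *_)
        (trans (cong suc (sym (length-map pair distinctPairs))) (sym (↭-length maximalMatchings-↭)))))
      where
      -- The induction runs over sublists of `distinctPairs`; membership there is what keeps the two
      -- edges of each pair different.
      sum-pairs : ∀ ps → (∀ {p} → p ∈ ps → p ∈ distinctPairs) → sum (map ∣_∣ (map pair ps)) ≡ 2 * length ps
      sum-pairs []             _  = refl
      sum-pairs ((w , z) ∷ ps) ⊆P = trans
        (cong₂ _+_ (∣⁅x⁆∪⁅y⁆∣≡2 uw≢vz) (sum-pairs ps (⊆P ∘ there)))
        (sym (*-distribˡ-+ 2 1 (length ps)))
        where
        uw≢vz : edge u w ≢ edge v z
        uw≢vz eq with w∈ , z∈ , _ ← ∈-distinctPairs⁻ (⊆P (here refl)) =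
          edge-v-∌u z∈ (subst (λ e → Inc e u) eq (edge-nbr w∈))

    -- Bounds on the degrees and their extreme cases

    -- The sizes add up to `length others + 2`, and `nbrs u` accounts for at most `length others`.
    2≤∣nbrs-v∣ : 2 ≤ length (nbrs v)
    2≤∣nbrs-v∣ = +-cancelˡ-≤ (length others) _ _
      (subst (_≤ length others + length (nbrs v)) (trans ∣nbrs∣-∪∩ (cong (length others +_) ∣common∣≡2))
        (+-monoˡ-≤ (length (nbrs v)) (length-filter (adj? u) others)))

    2≤∣nbrs-u∣ : 2 ≤ length (nbrs u)
    2≤∣nbrs-u∣ = +-cancelʳ-≤ (length others) _ _
      (subst (_≤ length (nbrs u) + length others)
        (trans ∣nbrs∣-∪∩ (trans (cong (length others +_) ∣common∣≡2) (+-comm (length others) 2)))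
        (+-monoʳ-≤ (length (nbrs u)) (length-filter (adj? v) others)))

    -- Then `nbrs u` is all of `others`, which leaves exactly 2 of the total for `nbrs v`.
    ∣nbrs-v∣≡2⁺ : (∀ {w} → w ∈ others → Adj u w) → length (nbrs v) ≡ 2
    ∣nbrs-v∣≡2⁺ u-adj = +-cancelˡ-≡ (length others) _ _
      (trans (cong (λ xs → length xs + length (nbrs v)) (sym (filter-all (adj? u) (All.tabulate u-adj))))
        (trans ∣nbrs∣-∪∩ (cong (length others +_) ∣common∣≡2)))

    -- A vertex not adjacent to `s` would be filtered out and make `nbrs s` strictly shorter than
    -- `others`.
    ∣nbrs∣≡∣others∣⇒adj : ∀ s → length (nbrs s) ≡ length others → ∀ {w} → w ∈ others → Adj s w
    ∣nbrs∣≡∣others∣⇒adj s eq {w} w∈ = decidable-stable (adj? s w) λ ¬sw →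
      <-irrefl eq (filter-notAll (adj? s) others (lose w∈ ¬sw))

    ∣nbrs-v∣≡2⁻ : length (nbrs v) ≡ 2 → ∀ {w} → w ∈ others → Adj u w
    ∣nbrs-v∣≡2⁻ q≡2 = ∣nbrs∣≡∣others∣⇒adj u (+-cancelʳ-≡ 2 _ _
      (trans (cong (length (nbrs u) +_) (sym q≡2)) (trans ∣nbrs∣-∪∩ (cong (length others +_) ∣common∣≡2))))

    ∣nbrs-u∣≡2⁻ : length (nbrs u) ≡ 2 → ∀ {w} → w ∈ others → Adj v w
    ∣nbrs-u∣≡2⁻ p≡2 = ∣nbrs∣≡∣others∣⇒adj v (+-cancelˡ-≡ 2 _ _
      (trans (cong (_+ length (nbrs v)) (sym p≡2)) (trans ∣nbrs∣-∪∩
        (trans (cong (length others +_) ∣common∣≡2) (+-comm (length others) 2)))))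

  -- The case without a dominating edge

  dominating? : ∀ u v → Dec (Dominating u v)
  dominating? u v = Dec.map′
    (λ (uv-adj , meets) → record { uv-adj = uv-adj ; meets-uv = meets _ _ })
    (λ D → Dominating.uv-adj D , λ _ _ → Dominating.meets-uv D)
    (adj? u v ×-dec all? λ i → all? λ j → adj? i j →-dec
      (((i Fin.≟ u) ⊎-dec (i Fin.≟ v)) ⊎-dec ((j Fin.≟ u) ⊎-dec (j Fin.≟ v))))

  -- The edges of M are not all equal to a single e, since e misses some edge f.
  2≤∣maximal∣ : (∀ u v → ¬ Dominating u v) → Fin ∣E∣ → ∀ {M} → IsMaximalMatching G M → 2 ≤ ∣ M ∣
  2≤∣maximal∣ ¬D e₁ {M} maxM with maximal-meets maxM e₁
  ... | e , e∈M , _ with edge-ends e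
  ...   | a , b , a≢b , ab , ea , eb with all? (λ f → meets? e f)
  ...     | yes e-meets = ⊥-elim (¬D a b record { uv-adj = ab ; meets-uv = hit })
    where
    hit : ∀ {i j} → Adj i j → (i ≡ a ⊎ i ≡ b) ⊎ (j ≡ a ⊎ j ≡ b)
    hit ij with f , fi , fj ← adj⇒edge ij with c , ec , fc ← e-meets f
      with inc-cover (λ i≡j → adj-irrefl i≡j ij) fi fj fc
    ... | inj₁ refl = inj₁ (inc-cover a≢b ea eb ec)
    ... | inj₂ refl = inj₂ (inc-cover a≢b ea eb ec)
  ...     | no ¬e-meets with f , ¬ef ← Fin.¬∀⟶∃¬ _ _ (λ f → meets? e f) ¬e-meets
    with g , g∈M , c , gc , fc ← maximal-meets maxM f =
    subst (_< ∣ M ∣) (Subset.∣⁅x⁆∣≡1 e) (Subset.p⊂q⇒∣p∣<∣q∣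
      ((λ x∈ → subst (Subset._∈ M) (sym (Subset.x∈⁅y⁆⇒x≡y e x∈)) e∈M) ,
       g , g∈M , λ g∈e → ¬ef (c , subst (λ h → Inc h c) (Subset.x∈⁅y⁆⇒x≡y e g∈e) gc , fc)))

  -- The argument in `Fin ∣E∣` excludes the graph without edges, whose only maximal matching is
  -- empty.
  2*∣maximalMatchings∣≤sum : (∀ u v → ¬ Dominating u v) → Fin ∣E∣ →
    2 * length (maximalMatchings G) ≤ sum (map ∣_∣ (maximalMatchings G))
  2*∣maximalMatchings∣≤sum ¬D e₁ = go (maximalMatchings G)
    (All.tabulate λ M∈ → 2≤∣maximal∣ ¬D e₁ (proj₂ (∈-filter⁻ (isMaximalMatching? G) {xs = allSubsets ∣E∣} M∈)))
    where
    go : ∀ Ms → All (λ M → 2 ≤ ∣ M ∣) Ms → 2 * length Ms ≤ sum (map ∣_∣ Ms)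
    go []       []       = z≤n
    go (M ∷ Ms) (2≤ ∷ p) = subst (_≤ ∣ M ∣ + sum (map ∣_∣ Ms)) (sym (*-distribˡ-+ 2 1 (length Ms))) (+-mono-≤ 2≤ (go Ms p))

  -- Recognising the extremal graph

  module _ (connected : Connected) {u v : Fin n} (D : Dominating u v) (∣E∣≡n+1 : ∣E∣ ≡ n + 1) where
    open Dominating D
    open Structure connected D ∣E∣≡n+1

    -- When u is adjacent to everything, v has only u and the two common neighbours x, y as
    -- neighbours, and all remaining vertices are leaves at u. Listing u, v, x, y and then the
    -- leaves numbers the vertices as in `θ¹₃₃`.
    center-adj⇒≅θ : (∀ {w} → w ∈ others → Adj u w) → G ≅ θ¹₃₃ n
    center-adj⇒≅θ u-adj with x , y , x≢y , common≡ ← ∃-common =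
      -- Positions in `L` live in `Fin (length L)`, so the isomorphism is built onto
      -- `θ¹₃₃ (length L)` and transported to n.
      subst (λ m → G ≅ θ¹₃₃ m) (trans (↭-length perm) (length-tabulate _))
        (mk↔ₛ′ pos (lookup L) pos-lookup (λ w → sym (lookup-index (∈L w))) , λ i j →
         mk⇔ (λ ij → to-θ (pos i) (pos j) (subst₂ Adj (lookup-index (∈L i)) (lookup-index (∈L j)) ij))
             (λ r → subst₂ Adj (sym (lookup-index (∈L i))) (sym (lookup-index (∈L j))) (from-θ (pos i) (pos j) r)))
      where
      leaves : List (Fin n)
      leaves = filter (λ w → ¬? (w Fin.≟ x) ×-dec ¬? (w Fin.≟ y)) others

      L : List (Fin n)
      L = u ∷ v ∷ x ∷ y ∷ leaves

      x∈ : x ∈ common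
      x∈ = subst (x ∈_) (sym common≡) (here refl)

      y∈ : y ∈ common
      y∈ = subst (y ∈_) (sym common≡) (there (here refl))

      ∈-leaves⁻ : ∀ {w} → w ∈ leaves → w ∈ others × (w ≢ x × w ≢ y)
      ∈-leaves⁻ = ∈-filter⁻ _

      ∈-others : ∀ {w} → w ∈ x ∷ y ∷ leaves → w ∈ others
      ∈-others (here refl)         = proj₁ (∈-common⁻ x∈)
      ∈-others (there (here refl)) = proj₁ (∈-common⁻ y∈)
      ∈-others (there (there w∈))  = proj₁ (∈-leaves⁻ w∈)

      ∈L : ∀ w → w ∈ L
      ∈L w with w Fin.≟ u | w Fin.≟ v | w Fin.≟ x | w Fin.≟ y
      ... | yes p | _     | _     | _     = here p
      ... | no _  | yes p | _     | _     = there (here p)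
      ... | no _  | no _  | yes p | _     = there (there (here p))
      ... | no _  | no _  | no _  | yes p = there (there (there (here p)))
      ... | no p  | no q  | no r  | no s  = there (there (there (there (∈-filter⁺ _ (∈-others⁺ p q) (r , s)))))

      L-unique : Unique L
      L-unique =
        (u≢v ∷ All.tabulate (λ w∈ u≡w → proj₁ (∈-others⁻ (∈-others w∈)) (sym u≡w))) ∷
        All.tabulate (λ w∈ v≡w → proj₂ (∈-others⁻ (∈-others w∈)) (sym v≡w)) ∷
        (x≢y ∷ All.tabulate (λ w∈ x≡w → proj₁ (proj₂ (∈-leaves⁻ w∈)) (sym x≡w))) ∷
        All.tabulate (λ w∈ y≡w → proj₂ (proj₂ (∈-leaves⁻ w∈)) (sym y≡w)) ∷
        Unique.filter⁺ _ others-unique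

      perm : L ↭ allFin n
      perm = unique∧set⇒↭ L-unique (Unique.allFin⁺ n) (λ _ → ∈-allFin _) (λ _ → ∈L _)

      pos : Fin n → Fin (length L)
      pos w = index (∈L w)

      pos-lookup : ∀ i → pos (lookup L i) ≡ i
      pos-lookup i = lookup-injective L-unique (sym (lookup-index (∈L (lookup L i))))

      -- A leaf adjacent to v would be a third common neighbour.
      v-leaf : ∀ k → ¬ Adj v (lookup leaves k)
      v-leaf k vw with w∈o , w≢x , w≢y ← ∈-leaves⁻ (∈-lookup k)
        with subst (lookup leaves k ∈_) common≡ (∈-common⁺ w∈o (u-adj w∈o) vw)
      ... | here w≡x         = w≢x w≡x
      ... | there (here w≡y) = w≢y w≡y

      to-θ : ∀ i j → Adj (lookup L i) (lookup L j) → SymClosure θ-Edge (toℕ i) (toℕ j)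
      to-θ zero zero a = ⊥-elim (adj-irrefl refl a)
      to-θ zero (suc zero) a = fwd uv
      to-θ zero (suc (suc zero)) a = fwd ux
      to-θ zero (suc (suc (suc zero))) a = fwd uy
      to-θ zero (suc (suc (suc (suc k)))) a = fwd (leaf (m≤m+n 4 _))
      to-θ (suc zero) zero a = bwd uv
      to-θ (suc zero) (suc zero) a = ⊥-elim (adj-irrefl refl a)
      to-θ (suc zero) (suc (suc zero)) a = fwd vx
      to-θ (suc zero) (suc (suc (suc zero))) a = fwd vy
      to-θ (suc zero) (suc (suc (suc (suc k)))) a = ⊥-elim (v-leaf k a)
      to-θ (suc (suc zero)) zero a = bwd ux
      to-θ (suc (suc (suc zero))) zero a = bwd uy
      to-θ (suc (suc (suc (suc k)))) zero a = bwd (leaf (m≤m+n 4 _))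
      to-θ (suc (suc zero)) (suc zero) a = bwd vx
      to-θ (suc (suc (suc zero))) (suc zero) a = bwd vy
      to-θ (suc (suc (suc (suc k)))) (suc zero) a = ⊥-elim (v-leaf k (adj-sym a))
      -- Two vertices other than u and v are never adjacent, since every edge meets {u, v}.
      to-θ (suc (suc i)) (suc (suc j)) a with meets-uv a
        | ∈-others⁻ (∈-others (∈-lookup i)) | ∈-others⁻ (∈-others (∈-lookup j))
      ... | inj₁ (inj₁ p) | ≢u , _ | _      = ⊥-elim (≢u p)
      ... | inj₁ (inj₂ p) | _ , ≢v | _      = ⊥-elim (≢v p)
      ... | inj₂ (inj₁ p) | _      | ≢u , _ = ⊥-elim (≢u p)
      ... | inj₂ (inj₂ p) | _      | _ , ≢v = ⊥-elim (≢v p)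

      from-edge : ∀ i j → θ-Edge (toℕ i) (toℕ j) → Adj (lookup L i) (lookup L j)
      from-edge zero zero (leaf ())
      from-edge zero (suc zero) _ = uv-adj
      from-edge zero (suc (suc k)) _ = u-adj (∈-others (∈-lookup k))
      from-edge (suc zero) (suc (suc zero)) _ = proj₂ (proj₂ (∈-common⁻ x∈))
      from-edge (suc zero) (suc (suc (suc zero))) _ = proj₂ (proj₂ (∈-common⁻ y∈))

      from-θ : ∀ i j → SymClosure θ-Edge (toℕ i) (toℕ j) → Adj (lookup L i) (lookup L j)
      from-θ i j (fwd r) = from-edge i j r
      from-θ i j (bwd r) = adj-sym (from-edge j i r)

-- The graph θ¹₃₃ and the final comparison

-- Each edge is oriented to start at u or v, which is why uv is dominating in `θ¹₃₃`.
θ-source : ∀ {a b} → θ-Edge a b → a ≡ 0 ⊎ a ≡ 1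
θ-source uv       = inj₁ refl
θ-source ux       = inj₁ refl
θ-source uy       = inj₁ refl
θ-source vx       = inj₂ refl
θ-source vy       = inj₂ refl
θ-source (leaf _) = inj₁ refl

θ-center : ∀ b → b ≢ 0 → θ-Edge 0 b
θ-center 0 b≢0 = ⊥-elim (b≢0 refl)
θ-center 1 _   = uv
θ-center 2 _   = ux
θ-center 3 _   = uy
θ-center (suc (suc (suc (suc b)))) _ = leaf (m≤m+n 4 b)

module _ {n : ℕ} (G : Graph n) (G≅θ : G ≅ θ¹₃₃ n) (2≤n : 2 ≤ n) where
  open Matchings G
  open Inverse (proj₁ G≅θ) using (to; from; strictlyInverseˡ; strictlyInverseʳ)

  -- For a = 0 and a = 1 these are the preimages of u and v under the isomorphism.
  vertex : ∀ {a} → a < 2 → Fin n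
  vertex a<2 = from (fromℕ< (≤-trans a<2 2≤n))

  private
    toℕ-to-vertex : ∀ {a} (a<2 : a < 2) → toℕ (to (vertex a<2)) ≡ a
    toℕ-to-vertex a<2 = trans (cong toℕ (strictlyInverseˡ _)) (Fin.toℕ-fromℕ< _)

    vertex-unique : ∀ {w a} (a<2 : a < 2) → toℕ (to w) ≡ a → w ≡ vertex a<2
    vertex-unique {w} a<2 eq = trans (sym (strictlyInverseʳ w))
      (cong from (Fin.toℕ-injective (trans eq (sym (Fin.toℕ-fromℕ< _)))))

    0<2 : 0 < 2
    0<2 = s≤s z≤n

    1<2 : 1 < 2
    1<2 = s≤s (s≤s z≤n)

  center center′ : Fin n
  center  = vertex 0<2
  center′ = vertex 1<2

  ≅θ⇒center-adj : ∀ {w} → w ≢ center → Adj center w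
  ≅θ⇒center-adj {w} w≢u = Equivalence.from (proj₂ G≅θ _ _)
    (subst (λ a → SymClosure θ-Edge a (toℕ (to w))) (sym (toℕ-to-vertex 0<2))
      (fwd (θ-center _ (w≢u ∘ vertex-unique 0<2))))

  ≅θ⇒dominating : Dominating center center′
  ≅θ⇒dominating = record { uv-adj = ≅θ⇒center-adj center′≢center ; meets-uv = meets }
    where
    center′≢center : center′ ≢ center
    center′≢center eq with () ← trans (sym (toℕ-to-vertex 1<2)) (trans (cong (toℕ ∘ to) eq) (toℕ-to-vertex 0<2))

    source : ∀ {i a} → θ-Edge (toℕ (to i)) a → i ≡ center ⊎ i ≡ center′
    source r = Sum.map (vertex-unique 0<2) (vertex-unique 1<2) (θ-source r)

    meets : ∀ {i j} → Adj i j → (i ≡ center ⊎ i ≡ center′) ⊎ (j ≡ center ⊎ j ≡ center′)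
    meets ij with Equivalence.to (proj₂ G≅θ _ _) ij
    ... | fwd r = inj₁ (source r)
    ... | bwd r = inj₂ (source r)

-- Here N and S are the number and the total size of the maximal matchings and
-- p, q are the degrees of u, v minus one; the bound is F / D.
module Arithmetic {n D F N S : ℕ} (D≡ : D + 5 ≡ 2 * n) (F≡ : F + 11 ≡ 4 * n) where
  open +-*-Solver using (solve; _:+_; _:*_; _:=_; con)

  -- This writes the bound as 2 - 1/D, to be compared with 2 - 1/N.
  F+1≡2D : 1 + F ≡ 2 * D
  -- After adding 10, both sides become 4n: the left is F + 11, the right is 2(D + 5).
  F+1≡2D = +-cancelʳ-≡ 10 _ _ (trans (solve 1 (λ f → con 1 :+ f :+ con 10 := f :+ con 11) refl F)
    (trans F≡ (trans (solve 1 (λ n → con 4 :* n := con 2 :* (con 2 :* n)) refl n)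
      (trans (cong (2 *_) (sym D≡)) (solve 1 (λ d → con 2 :* (d :+ con 5) := con 2 :* d :+ con 10) refl D)))))

  -- An average of at least 2 beats the bound strictly, because F is one less than 2D.
  FN<SD : 2 * N ≤ S → 0 < N → 0 < D → F * N < S * D
  FN<SD 2N≤S 0<N 0<D = begin-strict
    F * N         <⟨ m<n+m (F * N) 0<N ⟩
    N + F * N     ≡⟨⟩
    (1 + F) * N   ≡⟨ cong (_* N) F+1≡2D ⟩
    2 * D * N     ≡⟨ solve 2 (λ d n → con 2 :* d :* n := con 2 :* n :* d) refl D N ⟩
    2 * N * D     ≤⟨ *-monoˡ-≤ D 2N≤S ⟩
    S * D         ∎
    where open ≤-Reasoning

  -- Both sides equal 2DN. This is S/N - F/D = 1/D - 1/N with denominators and subtractions cleared.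
  FN+N≡SD+D : 1 + S ≡ 2 * N → N + F * N ≡ D + S * D
  FN+N≡SD+D S≡ = trans (cong (_* N) F+1≡2D)
    (trans (solve 2 (λ d n → con 2 :* d :* n := con 2 :* n :* d) refl D N) (cong (_* D) (sym S≡)))

  -- From pq = 2(p + q) - 4 + (p - 2)(q - 2) with p + q = n. Matching p and q as 2 + a and 2 + b
  -- removes the truncated subtractions.
  N≡D+ : ∀ {p q} → p + q ≡ n → 1 + N ≡ p * q → 2 ≤ p → 2 ≤ q → N ≡ D + (p ∸ 2) * (q ∸ 2)
  N≡D+ {suc (suc a)} {suc (suc b)} n≡ N≡ (s≤s (s≤s z≤n)) (s≤s (s≤s z≤n)) = +-cancelˡ-≡ 5 _ _
    (begin
      5 + N                                 ≡⟨ cong (4 +_) N≡ ⟩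
      4 + (2 + a) * (2 + b)                 ≡⟨ solve 2 (λ a b → con 4 :+ (con 2 :+ a) :* (con 2 :+ b) :=
                                                 con 2 :* ((con 2 :+ a) :+ (con 2 :+ b)) :+ a :* b) refl a b ⟩
      2 * ((2 + a) + (2 + b)) + a * b       ≡⟨ cong (λ m → 2 * m + a * b) n≡ ⟩
      2 * n + a * b                         ≡⟨ cong (_+ a * b) D≡ ⟨
      D + 5 + a * b                         ≡⟨ solve 2 (λ d c → d :+ con 5 :+ c := con 5 :+ (d :+ c)) refl D (a * b) ⟩
      5 + (D + a * b)                       ∎)
    where open ≡-Reasoning

-- The bound enters as F / D with F and D fixed by additive equations, so no truncated subtraction
-- of n has to be handled here.
module Comparison {n : ℕ} (G : Graph n) (2≤n : 2 ≤ n)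
    (connected : Graph.Connected G) (∣E∣≡n+1 : Graph.∣E∣ G ≡ n + 1)
    (D F : ℕ) (D≡ : D + 5 ≡ 2 * n) (F≡ : F + 11 ≡ 4 * n) .{{D≢0 : NonZero D}} where
  open Matchings G

  private
    N = length (maximalMatchings G)
    S = sum (map ∣_∣ (maximalMatchings G))

    instance
      N≢0 : NonZero N
      N≢0 = maximalMatchings-nonZero G

  open Arithmetic {n} {D} {F} {N} {S} D≡ F≡

  private
    edge₁ : Fin ∣E∣
    edge₁ = subst Fin (trans (+-comm 1 n) (sym ∣E∣≡n+1)) zero

  avm≡bound : N ≡ D → 1 + S ≡ 2 * N → avm G ≡ ℤ.+ F / D
  avm≡bound N≡D S≡ = /-≡⁺ S N F D
    (sym (+-cancelˡ-≡ N _ _ (trans (FN+N≡SD+D S≡) (cong (_+ S * D) (sym N≡D)))))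

  module _ {u v : Fin n} (dom : Dominating u v) where
    open Structure connected dom ∣E∣≡n+1

    N≡ : N ≡ D + (length (nbrs u) ∸ 2) * (length (nbrs v) ∸ 2)
    N≡ = N≡D+ ∣nbrs∣≡n ∣maximalMatchings∣ 2≤∣nbrs-u∣ 2≤∣nbrs-v∣

    -- By `FN+N≡SD+D` the inequality reduces to D ≤ N, which `N≡` shows.
    bound≤avm : ℤ.+ F / D ℚ.≤ avm G
    bound≤avm = /-≤ F D S N (+-cancelˡ-≤ D _ _
      (≤-trans (+-monoˡ-≤ (F * N) (m+n≤o⇒m≤o D (≤-reflexive (sym N≡)))) (≤-reflexive (FN+N≡SD+D sum-sizes))))

    star-equality : (∀ {w} → w ≢ u → Adj u w) → avm G ≡ ℤ.+ F / D
    star-equality u-adj = avm≡bound N≡D sum-sizes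
      where
      N≡D : N ≡ D
      N≡D = begin
        N                                                        ≡⟨ N≡ ⟩
        D + (length (nbrs u) ∸ 2) * (length (nbrs v) ∸ 2)        ≡⟨ cong (λ q → D + (length (nbrs u) ∸ 2) * (q ∸ 2))
                                                                      (∣nbrs-v∣≡2⁺ (λ w∈ → u-adj (proj₁ (∈-others⁻ w∈)))) ⟩
        D + (length (nbrs u) ∸ 2) * 0                            ≡⟨ cong (D +_) (*-zeroʳ (length (nbrs u) ∸ 2)) ⟩
        D + 0                                                    ≡⟨ +-identityʳ D ⟩
        D                                                        ∎
        where open ≡-Reasoning

    -- Equality forces N = D, so (p - 2)(q - 2) = 0. If q = 2 the centre is u; if p = 2 it is v.
    equality⇒≅θ : avm G ≡ ℤ.+ F / D → G ≅ θ¹₃₃ n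
    equality⇒≅θ eq = [ u-side , v-side ]′ (m*n≡0⇒m≡0∨n≡0 (length (nbrs u) ∸ 2) ab≡0)
      where
      N≡D : N ≡ D
      N≡D = +-cancelʳ-≡ (F * N) _ _ (trans (FN+N≡SD+D sum-sizes) (cong (D +_) (/-≡⁻ S N F D eq)))

      ab≡0 : (length (nbrs u) ∸ 2) * (length (nbrs v) ∸ 2) ≡ 0
      ab≡0 = +-cancelˡ-≡ D _ _ (trans (sym N≡) (trans N≡D (sym (+-identityʳ D))))

      -- With u and v exchanged, `others` has the same members but a different filter, so membership
      -- must be translated.
      module Flipped = Structure connected (dominating-sym dom) ∣E∣≡n+1

      u-side : length (nbrs u) ∸ 2 ≡ 0 → G ≅ θ¹₃₃ n
      u-side a≡0 = center-adj⇒≅θ connected (dominating-sym dom) ∣E∣≡n+1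
        λ w∈ → ∣nbrs-u∣≡2⁻ (≤-antisym (m∸n≡0⇒m≤n a≡0) 2≤∣nbrs-u∣)
          (∈-others⁺ (proj₂ (Flipped.∈-others⁻ w∈)) (proj₁ (Flipped.∈-others⁻ w∈)))

      v-side : length (nbrs v) ∸ 2 ≡ 0 → G ≅ θ¹₃₃ n
      v-side b≡0 = center-adj⇒≅θ connected dom ∣E∣≡n+1
        (∣nbrs-v∣≡2⁻ (≤-antisym (m∸n≡0⇒m≤n b≡0) 2≤∣nbrs-v∣))

  -- The isomorphism brings its own dominating edge, so this serves both branches of `avm-bound`.
  ≅θ⇒equality : G ≅ θ¹₃₃ n → avm G ≡ ℤ.+ F / D
  ≅θ⇒equality iso = star-equality (≅θ⇒dominating G iso 2≤n) (λ w≢u → ≅θ⇒center-adj G iso 2≤n w≢u)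

  module _ (¬dom : ∀ u v → ¬ Dominating u v) where

    ¬dom⇒FN<SD : F * N < S * D
    ¬dom⇒FN<SD = FN<SD (2*∣maximalMatchings∣≤sum ¬dom edge₁) (ℕ.>-nonZero⁻¹ N {{N≢0}}) (ℕ.>-nonZero⁻¹ D {{D≢0}})

    ¬dom⇒bound≤avm : ℤ.+ F / D ℚ.≤ avm G
    ¬dom⇒bound≤avm = /-≤ F D S N (<⇒≤ ¬dom⇒FN<SD)

    ¬dom⇒avm≢bound : avm G ≢ ℤ.+ F / D
    ¬dom⇒avm≢bound eq = <⇒≢ ¬dom⇒FN<SD (sym (/-≡⁻ S N F D eq))

  avm-bound : Dec (∃ λ u → ∃ λ v → Dominating u v) → (ℤ.+ F / D ℚ.≤ avm G) × (avm G ≡ ℤ.+ F / D ⇔ G ≅ θ¹₃₃ n)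
  avm-bound (yes (u , v , dom)) = bound≤avm dom , mk⇔ (equality⇒≅θ dom) ≅θ⇒equality
  avm-bound (no ¬dom) = ¬dom⇒bound≤avm (λ u v d → ¬dom (u , v , d)) ,
    mk⇔ (λ eq → ⊥-elim (¬dom⇒avm≢bound (λ u v d → ¬dom (u , v , d)) eq)) ≅θ⇒equality

theorem1p2 : ∀ (n : ℕ) (5≤n : 5 ≤ n) (G : Graph n) →
    Graph.Connected G → Graph.∣E∣ G ≡ n + 1 →
    (avm G ℚ.≥ bound n 5≤n) × (avm G ≡ bound n 5≤n ⇔ G ≅ θ¹₃₃ n)
theorem1p2 n 5≤n G connected ∣E∣≡n+1 = avm-bound (any? λ u → any? λ v → Matchings.dominating? G u v)
  where
  -- From n ≥ 5 follow 2n ≥ 10 ≥ 5 and 4n ≥ 20 ≥ 11, so both subtractions are exact.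
  open Comparison G (≤-trans (m≤m+n 2 3) 5≤n) connected ∣E∣≡n+1 (2 * n ∸ 5) (4 * n ∸ 11)
    (m∸n+n≡m (≤-trans (m≤m+n 5 5) (*-monoʳ-≤ 2 5≤n)))
    (m∸n+n≡m (≤-trans (m≤m+n 11 9) (*-monoʳ-≤ 4 5≤n)))
    {{2n∸5-nonZero 5≤n}}
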